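{- For every integer $n\geq 0$, $$11 \sum_{k=1}^{n} F_{4k} L_{6(n-k)} = 3 L_{6n} - 2F_{4n+4} + 18 F_{4n},$$ $$11 \sum_{k=1}^{n} F_{4k} L_{6(n-k)+3} = 3 L_{6n+3} - 4F_{4n+4} - 4 F_{4n},$$ $$11 \sum_{k=0}^{n} L_{4k+2} F_{6(n-k)+3} = 3 (F_{6n+9} - F_{6n+3}) - 2(L_{4n+6}-L_{4n+2}),$$ $$11 \sum_{k=0}^{n} L_{4k+2} F_{6(n-k)+6} = 3 (F_{6n+12} - F_{6n+6}) - 8L_{4n+6}.$$
   Context: $F_n$ and $L_n$ denote the Fibonacci and Lucas numbers: $F_0=0$, $F_1=1$, $L_0=2$, $L_1=1$, each satisfying $w_n=w_{n-1}+w_{n-2}$ for $n\ge 2$. A sum whose upper limit is smaller than its lower limit is $0$. -}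

module Defs where

open import Data.Nat.Base as ℕ using (ℕ; zero; suc; _∸_)
open import Data.Integer.Base using (ℤ; +_; _+_)
open import Data.List.Base using (applyUpTo; foldr)

F : ℕ → ℤ
F 0             = + 0
F 1             = + 1
F (suc (suc n)) = F (suc n) + F n

L : ℕ → ℤ
L 0             = + 2
L 1             = + 1
L (suc (suc n)) = L (suc n) + L n

-- There are suc b ∸ a terms f a, f (suc a), …, f b, so the sum is 0 when b < a.
sumFromTo : ℕ → ℕ → (ℕ → ℤ) → ℤ
sumFromTo a b f = foldr _+_ (+ 0) (applyUpTo (λ i → f (a ℕ.+ i)) (suc b ∸ a))

infix 8 sumFromTo
syntax sumFromTo a b (λ k → e) = ∑[ k from a to b ] e

{-# OPTIONS --safe #-}

-- If f and g satisfy f (k + 2) + f k = p f (k + 1) and g (k + 2) + g k = q g (k + 1),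
-- then U j m = f (j + 1) g (m + 1) − f j g m has
--   U j (m + 1) − U (j + 1) m = (q − p) f (j + 1) g (m + 1),
-- so (q − p) times the convolution of f and g telescopes.  Sampling a Fibonacci-type
-- sequence in steps of 4 and of 6 gives such recurrences with p = 7 and q = 18.
module Submission where

open import Defs
open import Data.Nat.Base as ℕ using (ℕ; zero; suc; _∸_)
import Data.Nat.Properties as ℕ
import Data.Nat.Tactic.RingSolver as ℕ-Solver
open import Data.Integer.Base using (ℤ; +_; -[1+_]; _+_; _*_; _-_)
open import Data.Integer.Tactic.RingSolver using (solve-∀)
open import Data.List.Base using (applyUpTo; foldr)
open import Data.Product.Base using (_×_; _,_)
open import Function.Base using (_∘_)
open import Relation.Binary.PropositionalEquality
  using (_≡_; refl; sym; trans; cong; cong₂; module ≡-Reasoning)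

open ≡-Reasoning

FibonacciType : (ℕ → ℤ) → Set
FibonacciType w = ∀ n → w (2 ℕ.+ n) ≡ w (1 ℕ.+ n) + w n

-- A record rather than a bare function type lets unification recover `p` and `f` from a proof.
record Recurrence (p : ℤ) (f : ℕ → ℤ) : Set where
  field
    step : ∀ k → f (2 ℕ.+ k) + f k ≡ p * f (1 ℕ.+ k)

open Recurrence

tail-recurrence : ∀ {p f} → Recurrence p f → Recurrence p (f ∘ suc)
tail-recurrence r .step k = r .step (suc k)

-- Extends a sequence back to index -1: the telescoped formula needs the term before the first one
-- summed.
prepend : ℤ → (ℕ → ℤ) → ℕ → ℤ
prepend a f zero    = a
prepend a f (suc k) = f k

prepend-recurrence : ∀ {p a f} → f 1 + a ≡ p * f 0 → Recurrence p f → Recurrence p (prepend a f)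
prepend-recurrence h r .step zero    = h
prepend-recurrence h r .step (suc k) = r .step k

fibonacciType-4 : ∀ w → FibonacciType w → ∀ n → w (4 ℕ.+ n) ≡ + 3 * w (1 ℕ.+ n) + + 2 * w n
fibonacciType-4 w r n rewrite r (2 ℕ.+ n) | r (1 ℕ.+ n) | r n = identity (w (1 ℕ.+ n)) (w n)
  where
  identity : ∀ x y → ((x + y) + x) + (x + y) ≡ + 3 * x + + 2 * y
  identity = solve-∀

fibonacciType-5 : ∀ w → FibonacciType w → ∀ n → w (5 ℕ.+ n) ≡ + 5 * w (1 ℕ.+ n) + + 3 * w n
fibonacciType-5 w r n rewrite fibonacciType-4 w r (1 ℕ.+ n) | r n = identity (w (1 ℕ.+ n)) (w n)
  where
  identity : ∀ x y → + 3 * (x + y) + + 2 * x ≡ + 5 * x + + 3 * y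
  identity = solve-∀

-- The case d = 4 of w(n+2d) + (-1)^d w(n) = L_d w(n+d), with L_4 = 7; d = 6 below has L_6 = 18.
fibonacciType-step4 : ∀ w → FibonacciType w → ∀ n →
  w (4 ℕ.+ (4 ℕ.+ n)) + w n ≡ + 7 * w (4 ℕ.+ n)
fibonacciType-step4 w r n
  rewrite fibonacciType-4 w r (4 ℕ.+ n) | fibonacciType-5 w r n | fibonacciType-4 w r n
  = identity (w (1 ℕ.+ n)) (w n)
  where
  identity : ∀ x y → + 3 * (+ 5 * x + + 3 * y) + + 2 * (+ 3 * x + + 2 * y) + y
                   ≡ + 7 * (+ 3 * x + + 2 * y)
  identity = solve-∀

fibonacciType-step6 : ∀ w → FibonacciType w → ∀ n →
  w (6 ℕ.+ (6 ℕ.+ n)) + w n ≡ + 18 * w (6 ℕ.+ n)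
fibonacciType-step6 w r n
  -- Indices descend from 12 to the pair 7, 6, then to 5, 4, and finally to 1, 0 (each plus `n`).
  rewrite r (10 ℕ.+ n) | fibonacciType-5 w r (6 ℕ.+ n) | fibonacciType-4 w r (6 ℕ.+ n)
        | r (5 ℕ.+ n) | r (4 ℕ.+ n) | fibonacciType-5 w r n | fibonacciType-4 w r n
  = identity (w (1 ℕ.+ n)) (w n)
  where
  identity : ∀ x y →
    let a = + 3 * x + + 2 * y ; b = + 5 * x + + 3 * y in
    (+ 5 * ((b + a) + b) + + 3 * (b + a)) + (+ 3 * ((b + a) + b) + + 2 * (b + a)) + y
      ≡ + 18 * (b + a)
  identity = solve-∀

subsequence-recurrence : ∀ {p} (w : ℕ → ℤ) d → (∀ n → w (d ℕ.+ (d ℕ.+ n)) + w n ≡ p * w (d ℕ.+ n)) →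
  Recurrence p (λ k → w (d ℕ.* k))
subsequence-recurrence w d h .step k
  rewrite ℕ.*-suc d (suc k) | ℕ.*-suc d k = h (d ℕ.* k)

step4-recurrence : ∀ w → FibonacciType w → Recurrence (+ 7) (λ k → w (4 ℕ.* k))
step4-recurrence w r = subsequence-recurrence w 4 (fibonacciType-step4 w r)

step6-recurrence : ∀ w → FibonacciType w → Recurrence (+ 18) (λ k → w (6 ℕ.* k))
step6-recurrence w r = subsequence-recurrence w 6 (fibonacciType-step6 w r)

-- Both indices start at 1, which keeps `f 0` and `g 0` for the boundary; the sums of the theorem
-- unfold to this shape definitionally.
convolution : (ℕ → ℤ) → (ℕ → ℤ) → ℕ → ℤ
convolution f g t = foldr _+_ (+ 0) (applyUpTo (λ i → f (suc i) * g (suc (t ∸ suc i))) t)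

-- The right side is U 0 t - U t 0. The induction must vary `f`: removing the first term leaves the
-- convolution of `f ∘ suc` with the same `g`.
*-convolution : ∀ {p q f g} → Recurrence p f → Recurrence q g → ∀ t →
  (q - p) * convolution f g t
    ≡ (f 1 * g (suc t) - f 0 * g t) - (f (suc t) * g 1 - f t * g 0)
*-convolution {p} {q} {f} {g} rf rg zero =
  identity (q - p) (f 1 * g 1 - f 0 * g 0)
  where
  identity : ∀ c u → c * + 0 ≡ u - u
  identity = solve-∀
*-convolution {p} {q} {f} {g} rf rg (suc t) = begin
  (q - p) * (f 1 * g (suc t) + convolution (f ∘ suc) g t)
    ≡⟨ distribute p q (f 1) (g (suc t)) (convolution (f ∘ suc) g t) ⟩
  (f 1 * (q * g (suc t)) - (p * f 1) * g (suc t)) + (q - p) * convolution (f ∘ suc) g t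
    -- The first summand becomes U 0 (t + 1) - U 1 t, and the induction hypothesis supplies U 1 t -
    -- U (t + 1) 0.
    ≡⟨ cong₂ _+_ (cong₂ (λ x y → f 1 * x - y * g (suc t)) (sym (rg .step t)) (sym (rf .step 0)))
                 (*-convolution (tail-recurrence rf) rg t) ⟩
  (f 1 * (g (2 ℕ.+ t) + g t) - (f 2 + f 0) * g (suc t))
    + ((f 2 * g (suc t) - f 1 * g t) - last)
    ≡⟨ telescope (f 0) (f 1) (f 2) (g t) (g (suc t)) (g (2 ℕ.+ t)) last ⟩
  (f 1 * g (2 ℕ.+ t) - f 0 * g (suc t)) - last ∎
  where
  last : ℤ
  last = f (2 ℕ.+ t) * g 1 - f (suc t) * g 0

  distribute : ∀ p q x y c → (q - p) * (x * y + c) ≡ (x * (q * y) - (p * x) * y) + (q - p) * c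
  distribute = solve-∀

  telescope : ∀ f₀ f₁ f₂ g₀ g₁ g₂ l →
    (f₁ * (g₂ + g₀) - (f₂ + f₀) * g₁) + ((f₂ * g₁ - f₁ * g₀) - l) ≡ (f₁ * g₂ - f₀ * g₁) - l
  telescope = solve-∀

*-suc-+ : ∀ d n c → d ℕ.* suc n ℕ.+ c ≡ d ℕ.* n ℕ.+ (d ℕ.+ c)
*-suc-+ = ℕ-Solver.solve-∀

*-suc′ : ∀ d n → d ℕ.* suc n ≡ d ℕ.* n ℕ.+ d
*-suc′ = ℕ-Solver.solve-∀

-- The prepended values are the terms of index −1: L₋₆ = 18, L₋₃ = −4, F₋₃ = 2, F₀ = 0
-- and L₋₂ = 3.
corollary10 : ∀ (n : ℕ) →
    (+ 11 * ∑[ k from 1 to n ] (F (4 ℕ.* k) * L (6 ℕ.* (n ∸ k)))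
    ≡ + 3 * L (6 ℕ.* n) - + 2 * F (4 ℕ.* n ℕ.+ 4) + + 18 * F (4 ℕ.* n))
    × (+ 11 * ∑[ k from 1 to n ] (F (4 ℕ.* k) * L (6 ℕ.* (n ∸ k) ℕ.+ 3))
    ≡ + 3 * L (6 ℕ.* n ℕ.+ 3) - + 4 * F (4 ℕ.* n ℕ.+ 4) - + 4 * F (4 ℕ.* n))
    × (+ 11 * ∑[ k from 0 to n ] (L (4 ℕ.* k ℕ.+ 2) * F (6 ℕ.* (n ∸ k) ℕ.+ 3))
    ≡ + 3 * (F (6 ℕ.* n ℕ.+ 9) - F (6 ℕ.* n ℕ.+ 3))
    - + 2 * (L (4 ℕ.* n ℕ.+ 6) - L (4 ℕ.* n ℕ.+ 2)))
    × (+ 11 * ∑[ k from 0 to n ] (L (4 ℕ.* k ℕ.+ 2) * F (6 ℕ.* (n ∸ k) ℕ.+ 6))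
    ≡ + 3 * (F (6 ℕ.* n ℕ.+ 12) - F (6 ℕ.* n ℕ.+ 6)) - + 8 * L (4 ℕ.* n ℕ.+ 6))
corollary10 n = part₁ , part₂ , part₃ , part₄
  where
  -- Nothing is prepended here: the sums with this factor start at k = 1, so F₀ is already the
  -- preceding term.
  F₄ : Recurrence (+ 7) (λ k → F (4 ℕ.* k))
  F₄ = step4-recurrence F (λ _ → refl)

  L₄₊₂ : Recurrence (+ 7) (prepend (+ 3) (λ k → L (4 ℕ.* k ℕ.+ 2)))
  L₄₊₂ = prepend-recurrence refl (step4-recurrence (λ k → L (k ℕ.+ 2)) (λ _ → refl))

  L₆ : Recurrence (+ 18) (prepend (+ 18) (λ k → L (6 ℕ.* k)))
  L₆ = prepend-recurrence refl (step6-recurrence L (λ _ → refl))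

  L₆₊₃ : Recurrence (+ 18) (prepend -[1+ 3 ] (λ k → L (6 ℕ.* k ℕ.+ 3)))
  L₆₊₃ = prepend-recurrence refl (step6-recurrence (λ k → L (k ℕ.+ 3)) (λ _ → refl))

  F₆₊₃ : Recurrence (+ 18) (prepend (+ 2) (λ k → F (6 ℕ.* k ℕ.+ 3)))
  F₆₊₃ = prepend-recurrence refl (step6-recurrence (λ k → F (k ℕ.+ 3)) (λ _ → refl))

  F₆₊₆ : Recurrence (+ 18) (prepend (+ 0) (λ k → F (6 ℕ.* k ℕ.+ 6)))
  F₆₊₆ = prepend-recurrence refl (step6-recurrence (λ k → F (k ℕ.+ 6)) (λ _ → refl))

  part₁ : + 11 * ∑[ k from 1 to n ] (F (4 ℕ.* k) * L (6 ℕ.* (n ∸ k)))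
        ≡ + 3 * L (6 ℕ.* n) - + 2 * F (4 ℕ.* n ℕ.+ 4) + + 18 * F (4 ℕ.* n)
  part₁ rewrite sym (*-suc′ 4 n) =
    -- The factor 11 is 18 - 7. Since F₀ = 0, the term L₆₍ₙ₋₁₎ drops out; the other coefficients are
    -- F₄ = 3, L₀ = 2 and L₋₆ = 18.
    trans (*-convolution F₄ L₆ n)
          (identity (L (6 ℕ.* n)) (prepend (+ 18) (λ k → L (6 ℕ.* k)) n)
                    (F (4 ℕ.* suc n)) (F (4 ℕ.* n)))
    where
    identity : ∀ x y u v → (+ 3 * x - + 0 * y) - (u * + 2 - v * + 18)
                         ≡ + 3 * x - + 2 * u + + 18 * v
    identity = solve-∀

  part₂ : + 11 * ∑[ k from 1 to n ] (F (4 ℕ.* k) * L (6 ℕ.* (n ∸ k) ℕ.+ 3))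
        ≡ + 3 * L (6 ℕ.* n ℕ.+ 3) - + 4 * F (4 ℕ.* n ℕ.+ 4) - + 4 * F (4 ℕ.* n)
  part₂ rewrite sym (*-suc′ 4 n) =
    trans (*-convolution F₄ L₆₊₃ n)
          (identity (L (6 ℕ.* n ℕ.+ 3)) (prepend -[1+ 3 ] (λ k → L (6 ℕ.* k ℕ.+ 3)) n)
                    (F (4 ℕ.* suc n)) (F (4 ℕ.* n)))
    where
    identity : ∀ x y u v → (+ 3 * x - + 0 * y) - (u * + 4 - v * -[1+ 3 ])
                         ≡ + 3 * x - + 4 * u - + 4 * v
    identity = solve-∀

  part₃ : + 11 * ∑[ k from 0 to n ] (L (4 ℕ.* k ℕ.+ 2) * F (6 ℕ.* (n ∸ k) ℕ.+ 3))
        ≡ + 3 * (F (6 ℕ.* n ℕ.+ 9) - F (6 ℕ.* n ℕ.+ 3))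
          - + 2 * (L (4 ℕ.* n ℕ.+ 6) - L (4 ℕ.* n ℕ.+ 2))
  part₃ rewrite sym (*-suc-+ 6 n 3) | sym (*-suc-+ 4 n 2) =
    -- A sum from 0 has n + 1 terms, hence `suc n`. The differences factor because L₋₂ = L₂ = 3 and
    -- F₋₃ = F₃ = 2.
    trans (*-convolution L₄₊₂ F₆₊₃ (suc n))
          (identity (F (6 ℕ.* suc n ℕ.+ 3)) (F (6 ℕ.* n ℕ.+ 3))
                    (L (4 ℕ.* suc n ℕ.+ 2)) (L (4 ℕ.* n ℕ.+ 2)))
    where
    identity : ∀ x y u v → (+ 3 * x - + 3 * y) - (u * + 2 - v * + 2)
                         ≡ + 3 * (x - y) - + 2 * (u - v)
    identity = solve-∀

  part₄ : + 11 * ∑[ k from 0 to n ] (L (4 ℕ.* k ℕ.+ 2) * F (6 ℕ.* (n ∸ k) ℕ.+ 6))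
        ≡ + 3 * (F (6 ℕ.* n ℕ.+ 12) - F (6 ℕ.* n ℕ.+ 6)) - + 8 * L (4 ℕ.* n ℕ.+ 6)
  part₄ rewrite sym (*-suc-+ 6 n 6) | sym (*-suc-+ 4 n 2) =
    -- Here the boundary values of the second factor are F₆ = 8 and F₀ = 0, so only one Lucas term
    -- survives.
    trans (*-convolution L₄₊₂ F₆₊₆ (suc n))
          (identity (F (6 ℕ.* suc n ℕ.+ 6)) (F (6 ℕ.* n ℕ.+ 6))
                    (L (4 ℕ.* suc n ℕ.+ 2)) (L (4 ℕ.* n ℕ.+ 2)))
    where
    identity : ∀ x y u v → (+ 3 * x - + 3 * y) - (u * + 8 - v * + 0)
                         ≡ + 3 * (x - y) - + 8 * u
    identity = solve-∀
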